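{- There exist a finite relational vocabulary and a class $K$ of finite structures of that vocabulary such that: (i) $K$ is finitely axiomatizable, i.e. $K$ is the class of all finite models of a single first-order sentence; (ii) every structure in $K$ is rigid; and (iii) there is no $L_{\infty,\omega}(C)$ formula $\phi(x,y)$ such that, for every $A\in K$, the relation $\{(a,b)\in A^2 : A\models\phi(a,b)\}$ is a linear order on the universe of $A$.
   Context: All structures are finite, and classes are closed under isomorphism. A structure is rigid if its only automorphism is the identity. $L_{\infty,\omega}$ is the logic built from atomic formulas by negation, existential and universal quantification, and conjunctions and disjunctions of arbitrary sets $S$ of formulas, provided the total number of variables occurring in the formulas of $S$ is finite. $L_{\infty,\omega}(C)$ is its extension by the counting quantifiers $(\exists i\, x)$ for $i=2,3,\dots$ (meaning "there exist at least $i$ elements $x$ such that"). -}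

module Defs where

open import Data.Nat using (ℕ; zero; suc; _+_)
open import Data.Fin using (Fin; zero; suc; _≟_)
open import Data.Fin.Permutation using (Permutation′; _⟨$⟩ʳ_)
open import Data.Vec using (Vec; map)
open import Data.Bool using (Bool; T)
open import Data.Product using (Σ; _×_)
open import Data.Sum using (_⊎_)
open import Relation.Nullary using (¬_; yes; no)
open import Relation.Binary.PropositionalEquality using (_≡_)
open import Relation.Binary.Structures using (IsStrictTotalOrder)
open import Function.Definitions using (Injective)

record Vocabulary : Set where
  field
    nsym  : ℕ
    arity : Fin nsym → ℕ
open Vocabulary public

record Structure (V : Vocabulary) : Set where
  field
    size : ℕ
    rel  : (r : Fin (nsym V)) → Vec (Fin size) (arity V r) → Bool
open Structure public

IsAutomorphism : {V : Vocabulary} (A : Structure V) → Permutation′ (size A) → Set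
IsAutomorphism {V} A π =
  (r : Fin (nsym V)) (v : Vec (Fin (size A)) (arity V r)) →
  rel A r (map (π ⟨$⟩ʳ_) v) ≡ rel A r v

Rigid : {V : Vocabulary} → Structure V → Set
Rigid A = (π : Permutation′ (size A)) → IsAutomorphism A π → (a : Fin (size A)) → π ⟨$⟩ʳ a ≡ a

data FO (V : Vocabulary) (n : ℕ) : Set where
  atom : (r : Fin (nsym V)) → Vec (Fin n) (arity V r) → FO V n
  equ  : Fin n → Fin n → FO V n
  neg  : FO V n → FO V n
  and  : FO V n → FO V n → FO V n
  or   : FO V n → FO V n → FO V n
  ex   : FO V (suc n) → FO V n
  all  : FO V (suc n) → FO V n

Sentence : Vocabulary → Set
Sentence V = FO V 0

extend : {m n : ℕ} → (Fin n → Fin m) → Fin m → Fin (suc n) → Fin m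
extend s a zero    = a
extend s a (suc i) = s i

SatFO : {V : Vocabulary} (A : Structure V) {n : ℕ} → FO V n → (Fin n → Fin (size A)) → Set
SatFO A (atom r v) s = T (rel A r (map s v))
SatFO A (equ i j)  s = s i ≡ s j
SatFO A (neg φ)    s = ¬ SatFO A φ s
SatFO A (and φ ψ)  s = SatFO A φ s × SatFO A ψ s
SatFO A (or φ ψ)   s = SatFO A φ s ⊎ SatFO A ψ s
SatFO A (ex φ)     s = Σ (Fin (size A)) λ a → SatFO A φ (extend s a)
SatFO A (all φ)    s = (a : Fin (size A)) → SatFO A φ (extend s a)

Models : {V : Vocabulary} → Structure V → Sentence V → Set
Models A ψ = SatFO A ψ (λ ())

-- L_{∞,ω}(C): formulas over a fixed finite stock of k variables x_0..x_{k-1}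
-- (variables may be re-quantified); conjunctions/disjunctions over arbitrary
-- index sets I. Every L_{∞,ω}(C) formula lies in some LC V k.

data LC (V : Vocabulary) (k : ℕ) : Set₁ where
  atom   : (r : Fin (nsym V)) → Vec (Fin k) (arity V r) → LC V k
  equ    : Fin k → Fin k → LC V k
  neg    : LC V k → LC V k
  bigAnd : (I : Set) → (I → LC V k) → LC V k
  bigOr  : (I : Set) → (I → LC V k) → LC V k
  ex     : Fin k → LC V k → LC V k
  all    : Fin k → LC V k → LC V k
  -- exAtLeast i x φ : there exist at least (2 + i) elements x with φ
  exAtLeast : ℕ → Fin k → LC V k → LC V k

update : {m k : ℕ} → (Fin k → Fin m) → Fin k → Fin m → Fin k → Fin m
update s x a y with y ≟ x
... | yes _ = a
... | no  _ = s y

SatLC : {V : Vocabulary} (A : Structure V) {k : ℕ} → LC V k → (Fin k → Fin (size A)) → Set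
SatLC A (atom r v)        s = T (rel A r (map s v))
SatLC A (equ i j)         s = s i ≡ s j
SatLC A (neg φ)           s = ¬ SatLC A φ s
SatLC A (bigAnd I f)      s = (i : I) → SatLC A (f i) s
SatLC A (bigOr I f)       s = Σ I λ i → SatLC A (f i) s
SatLC A (ex x φ)          s = Σ (Fin (size A)) λ a → SatLC A φ (update s x a)
SatLC A (all x φ)         s = (a : Fin (size A)) → SatLC A φ (update s x a)
SatLC A (exAtLeast i x φ) s =
  Σ (Fin (suc (suc i)) → Fin (size A)) λ g →
    Injective _≡_ _≡_ g × ((j : Fin (suc (suc i))) → SatLC A φ (update s x (g j)))

-- The binary relation defined in A by φ(x,y), where x = x_0 and y = x_1.
-- (Any other free variables are read universally, i.e. as in ∀ x_2 … x_{k-1} φ,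
-- which is again an L_{∞,ω}(C) formula with free variables among x, y.)
Defined : {V : Vocabulary} (A : Structure V) {m : ℕ} → LC V (suc (suc m)) →
          Fin (size A) → Fin (size A) → Set
Defined A φ a b = (s : Fin _ → Fin (size A)) → s zero ≡ a → s (suc zero) ≡ b → SatLC A φ s

IsLinearOrder : {n : ℕ} → (Fin n → Fin n → Set) → Set
IsLinearOrder R = IsStrictTotalOrder _≡_ R

{-# OPTIONS --safe #-}

-- Multipedes. A system over 𝔽₂ with three variables in each equation gives a
-- structure in which every variable carries two feet and every equation selects
-- the foot triples of even parity; automorphisms that fix all variables are
-- exactly the solutions. If every set of variables is itself an element, then
-- "no nonzero assignment is a solution" is a first-order condition, and it makes
-- the structure rigid. If in addition the incidence graph of the system has no
-- short cycles, then a chain of few equations has a boundary at least as large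
-- as the chain, so k pebbles never see the contradiction that fixes a foot: the
-- Duplicator keeps answering with locally consistent flips of feet, and wins the
-- bijective pebble game between (A, a, b) and (A, b, a) for the two feet a, b of
-- a variable.
--
-- Such systems come from the single equation x + x + x = 0 by repeated passage
-- to 2-covers. Covers keep the system nonsingular: the sum of a solution over the
-- two sheets solves the base, hence vanishes, hence so does the solution. A cover
-- with one bit for each incidence, switched exactly along it, opens up the
-- shortest cycles.
module Submission where

open import Defs
open import Algebra.Bundles using (CommutativeRing)
open import Data.Bool using (Bool; true; false; T; not; _∧_; _∨_; _xor_)
open import Data.Bool.Properties
  using (T?; T-∧; T-∨; T-≡; not-¬; not-involutive; ∧-zeroʳ; ∧-identityʳ;
         xor-assoc; xor-comm; xor-same; xor-identityʳ; xor-∧-commutativeRing)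
import Data.Bool.Properties as Bool
open import Data.Empty using (⊥-elim)
open import Data.Fin using (Fin; zero; suc; #_)
import Data.Fin as Fin
open import Data.Fin.Patterns using (0F; 1F; 2F; 3F)
open import Data.Fin.Permutation using (Permutation′; _⟨$⟩ʳ_)
import Data.Fin.Properties as Fin
open import Data.List
  using (List; []; _∷_; _++_; length; map; filter; tabulate; allFin; cartesianProduct)
open import Data.List.Membership.Propositional using (_∈_; _∉_; find; lose; _─_)
open import Data.List.Membership.Propositional.Properties
  using (∈-map⁺; ∈-map⁻; ∈-filter⁺; ∈-filter⁻; ∈-allFin; ∈-cartesianProduct⁺;
         ∈-++⁺ˡ; ∈-++⁺ʳ; ∈-++⁻; ∈-tabulate⁺; ∈-tabulate⁻)
open import Data.List.Properties
  using (length-map; length-++; length-tabulate; length-removeAt′; filter-notAll)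
open import Data.List.Relation.Unary.All using (All; []; _∷_)
import Data.List.Relation.Unary.All as All
open import Data.List.Relation.Unary.All.Properties using (¬Any⇒All¬)
open import Data.List.Relation.Unary.AllPairs using ([]; _∷_)
open import Data.List.Relation.Unary.Any using (Any; here; there)
import Data.List.Relation.Unary.Any as Any
open import Data.List.Relation.Unary.Unique.Propositional using (Unique)
open import Data.Nat using (ℕ; zero; suc; _+_; _*_; _^_; _≤_; _<_; _<ᵇ_; z≤n; s≤s)
import Data.Nat.Properties as ℕ
open import Data.Product using (Σ; _×_; _,_; proj₁; proj₂; ∃)
open import Data.Product.Function.NonDependent.Propositional using (_×-↔_)
open import Data.Sum using (_⊎_; inj₁; inj₂; [_,_]′)
import Data.Sum as Sum
open import Data.Sum.Function.Propositional using (_⊎-↔_)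
open import Data.Unit using (⊤; tt)
open import Data.Vec using (Vec; []; _∷_; lookup)
import Data.Vec as Vec
open import Data.Vec.Properties using (lookup∘tabulate; lookup-replicate; tabulate∘lookup; tabulate-cong)
open import Function using (_∘_; flip; _↔_; Inverse; mk↔ₛ′; Equivalence)
open import Function.Construct.Composition using (_↔-∘_)
open import Function.Definitions using (Injective)
open import Function.Properties.Inverse using (↔-sym; ↔⇒↣)
open import Relation.Binary.Definitions using (DecidableEquality; tri<; tri≈; tri>)
open import Relation.Binary.PropositionalEquality
  using (_≡_; _≢_; refl; sym; trans; cong; cong₂; subst; module ≡-Reasoning)
open import Relation.Binary.Structures using (IsStrictTotalOrder)
open import Relation.Nullary
  using (¬_; Dec; yes; no; does; contradiction; ¬?; _×-dec_; _⊎-dec_; _→-dec_)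
open import Relation.Nullary.Decidable
  using (via-injection; map′; dec-true; dec-false; toWitness; fromWitness; ⌊_⌋)
open import Algebra.Properties.CommutativeSemigroup
  (CommutativeRing.+-commutativeSemigroup xor-∧-commutativeRing) using (interchange)

xor-interchange : ∀ a b c d → (a xor b) xor (c xor d) ≡ (a xor c) xor (b xor d)
xor-interchange = interchange

-- Linear systems and their covers

-- A homogeneous linear system over 𝔽₂: each point serves both as a variable
-- and as an equation, and the equation e reads
-- x (slot e 0) + x (slot e 1) + x (slot e 2) = 0.
record System : Set₁ where
  field
    Point : Set
    order : ℕ
    enum  : Point ↔ Fin order
    slot  : Point → Fin 3 → Point

  _≟_ : DecidableEquality Point
  _≟_ = via-injection (↔⇒↣ enum) Fin._≟_

  δ : Point → Point → Bool
  δ v u = does (u ≟ v)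

  anyPoint? : {P : Point → Set} → (∀ v → Dec (P v)) → Dec (∃ P)
  anyPoint? {P} P? = map′
    (λ (i , p) → Inverse.from enum i , p)
    (λ (v , p) → Inverse.to enum v , subst P (sym (Inverse.strictlyInverseʳ enum v)) p)
    (Fin.any? (P? ∘ Inverse.from enum))

  parity : (Point → Bool) → Point → Bool
  parity f e = f (slot e 0F) xor (f (slot e 1F) xor f (slot e 2F))

  -- Incidences are compared, not equations: an equation of `g` in which a variable occurs twice
  -- shares that slot with itself, a cycle of length two in the incidence graph.
  Shared : List Point → Point → Fin 3 → Set
  Shared g e j = Any (λ e′ → ∃ λ j′ → slot e′ j′ ≡ slot e j × ¬ (e′ ≡ e × j′ ≡ j)) g

  TwoShared : List Point → Point → Set
  TwoShared g e = ∃ λ j → ∃ λ j′ → j ≢ j′ × Shared g e j × Shared g e j′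

  -- The exceptional `e₀` makes the notion stable under the cut in `cover-sparse`, which opens a
  -- cycle and may leave one loose end.
  NearCore : List Point → Set
  NearCore g = ∃ λ e₀ → e₀ ∈ g × (∃ λ j → Shared g e₀ j) ×
                 (∀ e → e ∈ g → e ≢ e₀ → TwoShared g e)

  parity-xor : ∀ f h e → parity (λ v → f v xor h v) e ≡ parity f e xor parity h e
  parity-xor f h e = trans
    (cong ((f (slot e 0F) xor h (slot e 0F)) xor_)
      (xor-interchange (f (slot e 1F)) (h (slot e 1F)) (f (slot e 2F)) (h (slot e 2F))))
    (xor-interchange (f (slot e 0F)) (h (slot e 0F)) _ _)

  Shared-mono : ∀ {g g′ e j} → (∀ {x} → x ∈ g → x ∈ g′) → Shared g e j → Shared g′ e j
  Shared-mono g⊆ s with e′ , e′∈ , p ← find s = lose (g⊆ e′∈) p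

-- Only the zero assignment solves the system.
Odd : System → Set
Odd S = ∀ f v → f v ≡ true → ∃ λ e → parity f e ≡ true
  where open System S

-- A set of equations whose incidence graph is a forest has two leaves, so a
-- near-core witnesses a cycle.
Sparse : System → ℕ → Set
Sparse S N = ∀ g → length g ≤ N → ¬ NearCore g
  where open System S

loop : System
loop = record
  { Point = ⊤ ; order = 1 ; enum = ↔-sym Fin.1↔⊤ ; slot = λ _ _ → tt }

loop-odd : Odd loop
loop-odd f v fv = tt , subst (λ b → b xor (b xor b) ≡ true) (sym fv) refl

loop-sparse : Sparse loop 0
loop-sparse [] _ (_ , () , _)

module _ (S : System) where
  open System S

  -- The 2-cover given by the voltage assignment `σ` on the incidences.
  double : (Point → Fin 3 → Bool) → System
  double σ = record
    { Point = Point × Bool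
    ; order = order * 2
    ; enum  = ↔-sym Fin.*↔× ↔-∘ (enum ×-↔ ↔-sym Fin.2↔Bool)
    ; slot  = λ (e , b) j → slot e j , b xor σ e j
    }

  -- If the sum of `f` over the two sheets is nonzero, it violates a base equation; the parities of
  -- the two lifts add up to `true`, so `f` violates one of them. Otherwise `f` is constant on
  -- fibres and descends to a nonzero assignment of the base.
  double-odd : ∀ σ → Odd S → Odd (double σ)
  double-odd σ odd f (v , b) fv with anyPoint? (λ u → (f (u , false) xor f (u , true)) Bool.≟ true)
  ... | yes (u , Fu) = let e , pe = odd (λ u → f (u , false) xor f (u , true)) u Fu in
        pick e _ _ refl refl (trans (split e) pe)
    where
    lifted : Point × Bool → Bool
    lifted = System.parity (double σ) f
    sheets : ∀ u b → f (u , b) xor f (u , not b) ≡ f (u , false) xor f (u , true)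
    sheets u false = refl
    sheets u true  = xor-comm (f (u , true)) _
    split : ∀ e → lifted (e , false) xor lifted (e , true) ≡
                  parity (λ u → f (u , false) xor f (u , true)) e
    split e = trans
      (sym (System.parity-xor (double σ) f (λ (u , b) → f (u , not b)) (e , false)))
      (cong₂ _xor_ (sheets _ (σ e 0F)) (cong₂ _xor_ (sheets _ (σ e 1F)) (sheets _ (σ e 2F))))
    pick : ∀ e x y → lifted (e , false) ≡ x → lifted (e , true) ≡ y →
           x xor y ≡ true → ∃ λ e′ → lifted e′ ≡ true
    pick e true  _    p _ _ = (e , false) , p
    pick e false true _ q _ = (e , true) , q
  ... | no ¬F = let e , pe = odd (λ u → f (u , false)) v (trans (sym (const v b)) fv) in
        (e , false) , trans (cong₂ _xor_ (const _ (σ e 0F))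
                        (cong₂ _xor_ (const _ (σ e 1F)) (const _ (σ e 2F)))) pe
    where
    same : ∀ x y → x xor y ≢ true → y ≡ x
    same false false _ = refl
    same false true  n = contradiction refl n
    same true  false n = contradiction refl n
    same true  true  _ = refl
    const : ∀ u b → f (u , b) ≡ f (u , false)
    const u false = refl
    const u true  = same (f (u , false)) (f (u , true)) λ eq → ¬F (u , eq)

-- bit: walking from an equation to one of its variables switches the bit of c
-- exactly when the step lies over the incidence c.
record Cover (S : System) (cs : List (System.Point S × Fin 3)) : Set₁ where
  private module S = System S
  field
    total  : System
  private module C = System total
  field
    π      : C.Point → S.Point
    π-slot : ∀ e j → π (C.slot e j) ≡ S.slot (π e) j
    -- Unique lifting at a variable: distinct incidences that meet there upstairs stay distinct
    -- downstairs, so shared slots remain shared under `π`.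
    π-lift : ∀ {e e′} j → π e ≡ π e′ → C.slot e j ≡ C.slot e′ j → e ≡ e′
    bit    : ∀ {c} → c ∈ cs → ∃ λ (β : C.Point → Bool) →
             ∀ e j → β (C.slot e j) ≡ β e xor (S.δ (proj₁ c) (π e) ∧ does (j Fin.≟ proj₂ c))
    over   : S.Point → C.Point
    odd    : Odd S → Odd total

xor-cancelʳ : ∀ c {a b} → a xor c ≡ b xor c → a ≡ b
xor-cancelʳ c {a} {b} eq = begin
  a             ≡⟨ xor-identityʳ a ⟨
  a xor false   ≡⟨ cong (a xor_) (xor-same c) ⟨
  a xor (c xor c) ≡⟨ xor-assoc a c c ⟨
  (a xor c) xor c ≡⟨ cong (_xor c) eq ⟩
  (b xor c) xor c ≡⟨ xor-assoc b c c ⟩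
  b xor (c xor c) ≡⟨ cong (b xor_) (xor-same c) ⟩
  b xor false   ≡⟨ xor-identityʳ b ⟩
  b ∎
  where open ≡-Reasoning

-- One doubling per listed incidence. Each switch is read off on the base, hence is on at all lifts
-- of its incidence; the bits of earlier doublings are pulled back.
cover : (S : System) → ∀ cs → Cover S cs
cover S [] = record
  { total = S ; π = λ e → e ; π-slot = λ _ _ → refl ; π-lift = λ _ eq _ → eq
  ; bit = λ () ; over = λ v → v ; odd = λ o → o }
cover S (c ∷ cs) = record
  { total  = double total switch
  ; π      = π ∘ proj₁
  ; π-slot = λ (e , _) j → π-slot e j
  ; π-lift = lift
  ; bit    = λ { (here refl) → proj₂ , λ _ _ → refl
               ; (there c∈) → let β , eq = bit c∈ in β ∘ proj₁ , λ (e , _) j → eq e j }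
  ; over   = λ v → over v , false
  ; odd    = double-odd total switch ∘ odd
  }
  where
  open Cover (cover S cs)
  switch : System.Point total → Fin 3 → Bool
  switch e j = System.δ S (proj₁ c) (π e) ∧ does (j Fin.≟ proj₂ c)
  lift : ∀ {e e′} j → π (proj₁ e) ≡ π (proj₁ e′) →
         System.slot (double total switch) e j ≡ System.slot (double total switch) e′ j → e ≡ e′
  lift {e , b} {e′ , b′} j πeq eq with refl ← π-lift j πeq (cong proj₁ eq) =
    cong (e ,_) (xor-cancelʳ (switch e j) (cong proj₂ eq))

module _ {S : System} {cs} (C : Cover S cs) where
  open Cover C
  private
    module S = System S
    module C = System total

  Shared-π : ∀ {g e j} → C.Shared g e j → S.Shared (map π g) (π e) j
  Shared-π {g} {e} {j} s with e′ , e′∈ , j′ , eq , ne ← find s = lose (∈-map⁺ π e′∈)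
    ( j′
    , trans (sym (π-slot e′ j′)) (trans (cong π eq) (π-slot e j))
    , λ { (πeq , refl) → ne (π-lift j πeq eq , refl) } )

  NearCore-π : ∀ {g} → C.NearCore g → S.NearCore (map π g)
  NearCore-π {g} (e₀ , e₀∈ , (j , s) , two) =
    π e₀ , ∈-map⁺ π e₀∈ , (j , Shared-π s) , two′
    where
    two′ : ∀ e → e ∈ map π g → e ≢ π e₀ → S.TwoShared (map π g) e
    two′ _ e∈ ne with e , e∈g , refl ← ∈-map⁻ π e∈ with j , j′ , j≢ , s , s′ ← two e e∈g (ne ∘ cong π) =
      j , j′ , j≢ , Shared-π s , Shared-π s′

∈-─⁻ : ∀ {A : Set} {x y : A} {xs} (p : x ∈ xs) → y ∈ xs ─ p → y ∈ xs
∈-─⁻ (here _)  q         = there q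
∈-─⁻ (there p) (here eq) = here eq
∈-─⁻ (there p) (there q) = there (∈-─⁻ p q)

∈-─⁺ : ∀ {A : Set} {x y : A} {xs} (p : x ∈ xs) → y ∈ xs → y ≢ x → y ∈ xs ─ p
∈-─⁺ (here refl) (here refl) y≢x = contradiction refl y≢x
∈-─⁺ (here _)    (there q)   _   = q
∈-─⁺ (there p)   (here eq)   _   = here eq
∈-─⁺ (there p)   (there q)   y≢x = there (∈-─⁺ p q y≢x)

length-─ : ∀ {A : Set} {x : A} {xs} (p : x ∈ xs) → length xs ≡ suc (length (xs ─ p))
length-─ {xs = xs} p = length-removeAt′ xs (Any.index p)

module _ {S : System} {cs} (C : Cover S cs) (complete : ∀ c → c ∈ cs) where
  open Cover C
  private
    module S = System S
    module C = System total

  NearCore-mono : ∀ {g g′} → (∀ {x} → x ∈ g → x ∈ g′) → (∀ {x} → x ∈ g′ → x ∈ g) →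
                  S.NearCore g → S.NearCore g′
  NearCore-mono ⊆ ⊇ (e₀ , e₀∈ , (j , s) , two) = e₀ , ⊆ e₀∈ , (j , S.Shared-mono ⊆ s) , λ e e∈ ne →
    let j , j′ , j≢ , s , s′ = two e (⊇ e∈) ne in j , j′ , j≢ , S.Shared-mono ⊆ s , S.Shared-mono ⊆ s′

  -- Cutting a near-core along the bit that belongs to one of its shared slots
  -- leaves a smaller near-core on one side.
  cover-sparse : ∀ {N} → Sparse S N → Sparse total (suc N)
  cover-sparse {N} sparse g len near@(e₀ , e₀∈ , (j₀ , s₀) , two)
    with Any.any? (λ e → (π e S.≟ π e₀) ×-dec ¬? (e C.≟ e₀)) g
  -- A second member over the base equation of `e₀` can be deleted without changing the image of `g`
  -- as a set, so the projected near-core fits the bound `N`.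
  ... | yes twin with e , e∈ , πe , e≢ ← find twin =
    sparse (map π (g ─ e∈))
      (subst (_≤ N) (sym (length-map π (g ─ e∈))) (ℕ.≤-pred (subst (_≤ suc N) (length-─ e∈) len)))
      (NearCore-mono shrink grow (NearCore-π C near))
    where
    shrink : ∀ {x} → x ∈ map π g → x ∈ map π (g ─ e∈)
    shrink x∈ with a , a∈ , refl ← ∈-map⁻ π x∈ with a C.≟ e
    ... | yes refl = subst (_∈ map π (g ─ e∈)) (sym πe) (∈-map⁺ π (∈-─⁺ e∈ e₀∈ (e≢ ∘ sym)))
    ... | no a≢e   = ∈-map⁺ π (∈-─⁺ e∈ a∈ a≢e)
    grow : ∀ {x} → x ∈ map π (g ─ e∈) → x ∈ map π g
    grow x∈ with a , a∈ , refl ← ∈-map⁻ π x∈ = ∈-map⁺ π (∈-─⁻ e∈ a∈)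
  -- Now `e₀` is alone over its base equation: among the incidences of `g`, only that of `e₀` at
  -- `j₀` switches the bit `β`.
  ... | no ¬twin with e₁ , e₁∈ , j₁ , eq₁ , ne₁ ← find s₀
                 with β , β-slot ← bit (complete (π e₀ , j₀)) =
    sparse (map π side) (subst (_≤ N) (sym (length-map π side)) (ℕ.≤-pred (ℕ.≤-trans side-< len)))
      (NearCore-π C (e₁ , e₁∈side , one , rest))
    where
    switch : C.Point → Fin 3 → Bool
    switch e j = S.δ (π e₀) (π e) ∧ does (j Fin.≟ j₀)

    switch-on : switch e₀ j₀ ≡ true
    switch-on = cong₂ _∧_ (dec-true (π e₀ S.≟ π e₀) refl) (dec-true (j₀ Fin.≟ j₀) refl)

    switch-off : ∀ {e} j → e ∈ g → ¬ (e ≡ e₀ × j ≡ j₀) → switch e j ≡ false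
    switch-off {e} j e∈ ne with e C.≟ e₀
    ... | yes refl = trans (cong (_ ∧_) (dec-false (j Fin.≟ j₀) λ j≡ → ne (refl , j≡))) (∧-zeroʳ _)
    ... | no e≢    = cong (_∧ _) (dec-false (π e S.≟ π e₀) λ πe → ¬twin (lose e∈ (πe , e≢)))

    β-stays : ∀ {e} j → e ∈ g → ¬ (e ≡ e₀ × j ≡ j₀) → β (C.slot e j) ≡ β e
    β-stays {e} j e∈ ne = trans (β-slot e j)
      (trans (cong (β e xor_) (switch-off j e∈ ne)) (xor-identityʳ (β e)))

    off-side? : ∀ e → Dec (β e ≢ β e₀)
    off-side? e = ¬? (β e Bool.≟ β e₀)

    side : List C.Point
    side = filter off-side? g

    side-< : length side < length g
    side-< = filter-notAll off-side? g (lose e₀∈ (λ ne → ne refl))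

    -- The shared variable is reached from `e₀` by a switched step and from `e₁` by an unswitched
    -- one. In particular `e₁` differs from `e₀`.
    e₁∈side : e₁ ∈ side
    e₁∈side = ∈-filter⁺ off-side? e₁∈ λ same → not-¬ refl (begin
      β e₀                  ≡⟨ same ⟨
      β e₁                  ≡⟨ β-stays j₁ e₁∈ ne₁ ⟨
      β (C.slot e₁ j₁)      ≡⟨ cong β eq₁ ⟩
      β (C.slot e₀ j₀)      ≡⟨ β-slot e₀ j₀ ⟩
      β e₀ xor switch e₀ j₀ ≡⟨ cong (β e₀ xor_) switch-on ⟩
      β e₀ xor true         ≡⟨ xor-comm (β e₀) true ⟩
      not (β e₀)            ∎)
      where open ≡-Reasoning

    side⁻ : ∀ {e} → e ∈ side → e ∈ g × β e ≢ β e₀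
    side⁻ = ∈-filter⁻ off-side? {xs = g}

    -- Only the partner at slot `j₀` of `e₀` can be cut off. Slot `j₁` of `e₁` meets the same
    -- variable and replaces it, unless it is the slot under consideration.
    stays : ∀ {e} j → e ∈ side → C.Shared g e j → C.Shared side e j ⊎ (e₁ ≡ e × j₁ ≡ j)
    stays {e} j e∈side s with e∈ , off ← side⁻ e∈side
                         with e′ , e′∈ , j′ , eq , ne ← find s
                         with (e′ C.≟ e₀) ×-dec (j′ Fin.≟ j₀)
    ... | no ne₀ = inj₁ (lose (∈-filter⁺ off-side? e′∈ (off ∘ trans same)) (j′ , eq , ne))
      where
      same : β e ≡ β e′
      same = begin
        β e            ≡⟨ β-stays j e∈ (λ (e≡ , _) → off (cong β e≡)) ⟨
        β (C.slot e j) ≡⟨ cong β eq ⟨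
        β (C.slot e′ j′) ≡⟨ β-stays j′ e′∈ ne₀ ⟩
        β e′           ∎
        where open ≡-Reasoning
    ... | yes (refl , refl) with (e₁ C.≟ e) ×-dec (j₁ Fin.≟ j)
    ...   | yes same = inj₂ same
    ...   | no  ne′  = inj₁ (lose e₁∈side (j₁ , trans eq₁ eq , ne′))

    two-side : ∀ {e} → e ∈ side → C.TwoShared g e
    two-side e∈side with e∈ , off ← side⁻ e∈side = two _ e∈ (off ∘ cong β)

    -- Of its two shared slots `e₁` can lose only `j₁`, so it becomes the exceptional equation of
    -- the new near-core.
    one : ∃ λ j → C.Shared side e₁ j
    one with j , j′ , j≢ , s , s′ ← two-side e₁∈side
        with stays j e₁∈side s | stays j′ e₁∈side s′
    ... | inj₁ t          | _               = j , t
    ... | inj₂ _          | inj₁ t          = j′ , t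
    ... | inj₂ (_ , j₁≡j) | inj₂ (_ , j₁≡j′) = contradiction (trans (sym j₁≡j) j₁≡j′) j≢

    rest : ∀ e → e ∈ side → e ≢ e₁ → C.TwoShared side e
    rest e e∈side e≢ with j , j′ , j≢ , s , s′ ← two-side e∈side
        with stays j e∈side s | stays j′ e∈side s′
    ... | inj₁ t         | inj₁ t′        = j , j′ , j≢ , t , t′
    ... | inj₂ (e₁≡ , _) | _              = contradiction (sym e₁≡) e≢
    ... | _              | inj₂ (e₁≡ , _) = contradiction (sym e₁≡) e≢

points : (S : System) → List (System.Point S)
points S = map (Inverse.from (System.enum S)) (allFin _)

∈-points : (S : System) (v : System.Point S) → v ∈ points S
∈-points S v = subst (_∈ points S) (Inverse.strictlyInverseʳ (System.enum S) v)
  (∈-map⁺ _ (∈-allFin _))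

-- Each round doubles along all incidences of the current system and gains one unit of sparsity. The
-- point supplies the variable whose two feet will be confused.
sparse-odd-system : ∀ N → Σ System λ S → System.Point S × Sparse S N × Odd S
sparse-odd-system zero    = loop , tt , loop-sparse , loop-odd
sparse-odd-system (suc N) =
  let S , z , sparse , odd = sparse-odd-system N
      C = cover S (cartesianProduct (points S) (allFin 3))
  in Cover.total C
   , Cover.over C z
   , cover-sparse C (λ (e , j) → ∈-cartesianProduct⁺ (∈-points S e) (∈-allFin j)) sparse
   , Cover.odd C odd

∉-─ : ∀ {A : Set} {x : A} {xs} → Unique xs → (p : x ∈ xs) → x ∉ xs ─ p
∉-─ (x∉ ∷ _) (here refl) q         = All.lookup x∉ q refl
∉-─ (y∉ ∷ _) (there p) (here refl) = All.lookup y∉ p refl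
∉-─ (_ ∷ u)  (there p) (there q)   = ∉-─ u p q

Unique-─ : ∀ {A : Set} {x : A} {xs} → Unique xs → (p : x ∈ xs) → Unique (xs ─ p)
Unique-─ (_ ∷ u)  (here _)  = u
Unique-─ (y∉ ∷ u) (there p) = All.tabulate (λ q → All.lookup y∉ (∈-─⁻ p q)) ∷ Unique-─ u p

third : ∀ {j j′ : Fin 3} → j ≢ j′ → ∃ λ j″ → ∀ i → i ≡ j ⊎ i ≡ j′ ⊎ i ≡ j″
third {0F} {0F} ne = contradiction refl ne
third {0F} {1F} _  = 2F , λ { 0F → inj₁ refl ; 1F → inj₂ (inj₁ refl) ; 2F → inj₂ (inj₂ refl) }
third {0F} {2F} _  = 1F , λ { 0F → inj₁ refl ; 2F → inj₂ (inj₁ refl) ; 1F → inj₂ (inj₂ refl) }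
third {1F} {0F} _  = 2F , λ { 1F → inj₁ refl ; 0F → inj₂ (inj₁ refl) ; 2F → inj₂ (inj₂ refl) }
third {1F} {1F} ne = contradiction refl ne
third {1F} {2F} _  = 0F , λ { 1F → inj₁ refl ; 2F → inj₂ (inj₁ refl) ; 0F → inj₂ (inj₂ refl) }
third {2F} {0F} _  = 1F , λ { 2F → inj₁ refl ; 0F → inj₂ (inj₁ refl) ; 1F → inj₂ (inj₂ refl) }
third {2F} {1F} _  = 0F , λ { 2F → inj₁ refl ; 1F → inj₂ (inj₁ refl) ; 0F → inj₂ (inj₂ refl) }
third {2F} {2F} ne = contradiction refl ne

-- Chains of equations and local extension of flips

module Chains (S : System) where
  open System S

  -- Lists serve as chains over 𝔽₂ with concatenation as addition; this is the pairing of an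
  -- assignment with a chain.
  sumParity : (Point → Bool) → List Point → Bool
  sumParity f []      = false
  sumParity f (e ∷ g) = parity f e xor sumParity f g

  boundary : List Point → Point → Bool
  boundary g v = sumParity (δ v) g

  sumParity-++ : ∀ f g h → sumParity f (g ++ h) ≡ sumParity f g xor sumParity f h
  sumParity-++ f []      h = refl
  sumParity-++ f (e ∷ g) h = trans (cong (parity f e xor_) (sumParity-++ f g h)) (sym (xor-assoc (parity f e) _ _))

  sumParity-xor : ∀ f h g → sumParity (λ v → f v xor h v) g ≡ sumParity f g xor sumParity h g
  sumParity-xor f h []      = refl
  sumParity-xor f h (e ∷ g) = trans (cong₂ _xor_ (parity-xor f h e) (sumParity-xor f h g))
                                    (xor-interchange (parity f e) _ _ _)

  sumParity-∧ : ∀ d f g → sumParity (λ v → d ∧ f v) g ≡ d ∧ sumParity f g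
  sumParity-∧ true  f g       = refl
  sumParity-∧ false f []      = refl
  sumParity-∧ false f (e ∷ g) = sumParity-∧ false f g

  sumParity-─ : ∀ f {e g} (p : e ∈ g) → sumParity f g ≡ parity f e xor sumParity f (g ─ p)
  sumParity-─ f (here refl) = refl
  sumParity-─ f {e} {e′ ∷ g} (there p) = begin
    parity f e′ xor sumParity f g                            ≡⟨ cong (parity f e′ xor_) (sumParity-─ f p) ⟩
    parity f e′ xor (parity f e xor sumParity f (g ─ p)) ≡⟨ xor-assoc (parity f e′) _ _ ⟨
    (parity f e′ xor parity f e) xor sumParity f (g ─ p) ≡⟨ cong (_xor _) (xor-comm (parity f e′) _) ⟩
    (parity f e xor parity f e′) xor sumParity f (g ─ p) ≡⟨ xor-assoc (parity f e) _ _ ⟩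
    parity f e xor (parity f e′ xor sumParity f (g ─ p)) ∎
    where open ≡-Reasoning

  -- Repeated members cancel in pairs. Taking `f` to be `δ v` shows that the boundary is preserved
  -- as well.
  reduce : ∀ g → ∃ λ g′ → Unique g′ × length g′ ≤ length g × (∀ f → sumParity f g′ ≡ sumParity f g)
  reduce [] = [] , [] , z≤n , λ _ → refl
  reduce (e ∷ g) with g′ , u , len , eq ← reduce g with Any.any? (e ≟_) g′
  ... | no  e∉ = e ∷ g′ , ¬Any⇒All¬ g′ e∉ ∷ u , s≤s len , λ f → cong (parity f e xor_) (eq f)
  ... | yes e∈ = g′ ─ e∈ , Unique-─ u e∈
               , ℕ.≤-trans (ℕ.n≤1+n _) (ℕ.≤-trans (ℕ.≤-reflexive (sym (length-─ e∈))) (ℕ.m≤n⇒m≤1+n len))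
               , λ f → begin
      sumParity f (g′ ─ e∈)
        ≡⟨ cong (_xor sumParity f (g′ ─ e∈)) (xor-same (parity f e)) ⟨
      (parity f e xor parity f e) xor sumParity f (g′ ─ e∈)
        ≡⟨ xor-assoc (parity f e) _ _ ⟩
      parity f e xor (parity f e xor sumParity f (g′ ─ e∈))
        ≡⟨ cong (parity f e xor_) (sumParity-─ f e∈) ⟨
      parity f e xor sumParity f g′
        ≡⟨ cong (parity f e xor_) (eq f) ⟩
      parity f e xor sumParity f g ∎
    where open ≡-Reasoning

  parity-false : ∀ f e → (∀ j → f (slot e j) ≡ false) → parity f e ≡ false
  parity-false f e off = cong₂ _xor_ (off 0F) (cong₂ _xor_ (off 1F) (off 2F))

  parity-single : ∀ f e j → f (slot e j) ≡ true → (∀ i → i ≢ j → f (slot e i) ≡ false) → parity f e ≡ true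
  parity-single f e 0F on off = cong₂ _xor_ on (cong₂ _xor_ (off 1F λ ()) (off 2F λ ()))
  parity-single f e 1F on off = cong₂ _xor_ (off 0F λ ()) (cong₂ _xor_ on (off 2F λ ()))
  parity-single f e 2F on off = cong₂ _xor_ (off 0F λ ()) (cong₂ _xor_ (off 1F λ ()) on)

  δ-true : ∀ {v u} → u ≡ v → δ v u ≡ true
  δ-true {v} {u} = dec-true (u ≟ v)

  δ-false : ∀ {v u} → u ≢ v → δ v u ≡ false
  δ-false {v} {u} = dec-false (u ≟ v)

  boundary-∉ : ∀ {v} g → (∀ e j → e ∈ g → slot e j ≢ v) → boundary g v ≡ false
  boundary-∉ []      _  = refl
  boundary-∉ {v} (e ∷ g) ne = cong₂ _xor_ (parity-false (δ v) e λ j → δ-false (ne e j (here refl)))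
                                      (boundary-∉ g λ e j e∈ → ne e j (there e∈))

  shared? : ∀ g e j → Dec (Shared g e j)
  shared? g e j = Any.any? (λ e′ → Fin.any? λ j′ →
    (slot e′ j′ ≟ slot e j) ×-dec ¬? ((e′ ≟ e) ×-dec (j′ Fin.≟ j))) g

  Leaf : List Point → Point → Set
  Leaf g e = ∃ λ j → ∃ λ j′ → j ≢ j′ × ¬ Shared g e j × ¬ Shared g e j′

  leaf-or-two : ∀ g e → Leaf g e ⊎ TwoShared g e
  leaf-or-two g e with shared? g e 0F | shared? g e 1F | shared? g e 2F
  ... | yes s | yes t | _     = inj₂ (0F , 1F , (λ ()) , s , t)
  ... | yes s | no _  | yes t = inj₂ (0F , 2F , (λ ()) , s , t)
  ... | no _  | yes s | yes t = inj₂ (1F , 2F , (λ ()) , s , t)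
  ... | no s  | no t  | _     = inj₁ (0F , 1F , (λ ()) , s , t)
  ... | no s  | yes _ | no t  = inj₁ (0F , 2F , (λ ()) , s , t)
  ... | yes _ | no s  | no t  = inj₁ (1F , 2F , (λ ()) , s , t)

  -- Without a leaf every member would have two shared slots, and `g` would be a near-core.
  leaf : ∀ {N} → Sparse S N → ∀ {e₀} g → e₀ ∈ g → length g ≤ N → ∃ λ e → e ∈ g × Leaf g e
  leaf sparse {e₀} g e₀∈ len = [ (λ l → l) , (λ two → contradiction (core two) (sparse g len)) ]′
                                 (scan g λ e∈ → e∈)
    where
    scan : ∀ xs → (∀ {e} → e ∈ xs → e ∈ g) →
           (∃ λ e → e ∈ g × Leaf g e) ⊎ (∀ e → e ∈ xs → TwoShared g e)
    scan [] _ = inj₂ λ _ ()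
    scan (e ∷ xs) ⊆g with leaf-or-two g e | scan xs (⊆g ∘ there)
    ... | inj₁ l | _        = inj₁ (e , ⊆g (here refl) , l)
    ... | inj₂ _ | inj₁ l   = inj₁ l
    ... | inj₂ t | inj₂ two = inj₂ λ { _ (here refl) → t ; e (there e∈) → two e e∈ }
    core : (∀ e → e ∈ g → TwoShared g e) → NearCore g
    core two with j , _ , _ , s , _ ← two e₀ e₀∈ = e₀ , e₀∈ , (j , s) , λ e e∈ _ → two e e∈

  module _ {g e} (unique : Unique g) (e∈ : e ∈ g) {j} (private-j : ¬ Shared g e j) where

    private-alone : ∀ i → i ≢ j → slot e i ≢ slot e j
    private-alone i i≢j eq = private-j (lose e∈ (i , eq , i≢j ∘ proj₂))

    -- Uniqueness of `g` matters here: a second copy of `e` would bring the variable back.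
    private-∂-rest : boundary (g ─ e∈) (slot e j) ≡ false
    private-∂-rest = boundary-∉ (g ─ e∈) λ e′ i e′∈ eq → private-j
      (lose (∈-─⁻ e∈ e′∈) (i , eq , λ { (refl , _) → ∉-─ unique e∈ e′∈ }))

    private-∂ : boundary g (slot e j) ≡ true
    private-∂ = begin
      boundary g (slot e j)
        ≡⟨ sumParity-─ (δ (slot e j)) e∈ ⟩
      parity (δ (slot e j)) e xor boundary (g ─ e∈) (slot e j)
        ≡⟨ cong₂ _xor_ (parity-single (δ (slot e j)) e j (δ-true refl) λ i i≢j → δ-false (private-alone i i≢j))
                       private-∂-rest ⟩
      true ∎
      where open ≡-Reasoning

  -- Peeling off a leaf trades two boundary points for at most one new one.
  length≤boundary : ∀ {N} → Sparse S N → ∀ n g W → length g ≡ n → Unique g → n ≤ N →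
                    (∀ v → boundary g v ≡ true → v ∈ W) → n ≤ length W
  length≤boundary sparse zero g W _ _ _ _ = z≤n
  length≤boundary {N} sparse (suc n) g@(x ∷ _) W len u n≤N ∂⊆
    with e , e∈ , j , j′ , j≢ , pj , pj′ ← leaf sparse g (here refl) (subst (_≤ N) (sym len) n≤N)
    with j″ , cases ← third j≢ = ℕ.≤-trans (s≤s peeled) (ℕ.≤-trans (s≤s drop′) drop)
    where
    other? : ∀ i v → Dec (v ≢ slot e i)
    other? i v = ¬? (v ≟ slot e i)
    W₁ = filter (other? j) W
    W₂ = filter (other? j′) W₁
    drop : length W₁ < length W
    drop = filter-notAll (other? j) W (lose (∂⊆ _ (private-∂ u e∈ pj)) λ ne → ne refl)
    drop′ : length W₂ < length W₁
    drop′ = filter-notAll (other? j′) W₁ (lose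
      (∈-filter⁺ (other? j) (∂⊆ _ (private-∂ u e∈ pj′)) (private-alone u e∈ pj j′ (j≢ ∘ sym)))
      λ ne → ne refl)
    ∂⊆′ : ∀ v → boundary (g ─ e∈) v ≡ true → v ∈ slot e j″ ∷ W₂
    ∂⊆′ v ∂v with v ≟ slot e j | v ≟ slot e j′ | v ≟ slot e j″
    ... | yes refl | _        | _     = contradiction (trans (sym ∂v) (private-∂-rest u e∈ pj)) λ ()
    ... | no _     | yes refl | _     = contradiction (trans (sym ∂v) (private-∂-rest u e∈ pj′)) λ ()
    ... | no _     | no _     | yes p = here p
    ... | no v≢j   | no v≢j′  | no v≢j″ = there (∈-filter⁺ (other? j′) (∈-filter⁺ (other? j) (∂⊆ v ∂g) v≢j) v≢j′)
      where
      away : ∀ i → slot e i ≢ v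
      away i eq with cases i
      ... | inj₁ refl        = v≢j (sym eq)
      ... | inj₂ (inj₁ refl) = v≢j′ (sym eq)
      ... | inj₂ (inj₂ refl) = v≢j″ (sym eq)
      ∂g : boundary g v ≡ true
      ∂g = trans (sumParity-─ (δ v) e∈)
             (cong₂ _xor_ (parity-false (δ v) e λ i → δ-false (away i)) ∂v)
    peeled : n ≤ suc (length W₂)
    peeled = length≤boundary sparse n (g ─ e∈) (slot e j″ ∷ W₂)
      (ℕ.suc-injective (trans (sym (length-─ e∈)) len)) (Unique-─ u e∈)
      (ℕ.≤-trans (ℕ.n≤1+n n) n≤N) ∂⊆′

  -- Sparsity is doubled because two chains of length at most `K` are compared through their
  -- concatenation.
  module Flips (K : ℕ) (sparse : Sparse S (K + K)) where

    -- f is a flip of the feet over W that no short chain of equations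
    -- supported on W can tell from an automorphism.
    Good : (Point → Bool) → List Point → Set
    Good f W = ∀ g → length g ≤ K → (∀ v → boundary g v ≡ true → v ∈ W) → sumParity f g ≡ false

    Good-⊇ : ∀ {f W W′} → (∀ {v} → v ∈ W′ → v ∈ W) → Good f W → Good f W′
    Good-⊇ W′⊆W good g len ∂⊆ = good g len λ v ∂v → W′⊆W (∂⊆ v ∂v)

    -- After cancellation the chain is no longer than its boundary, hence at most `length W ≤ K`,
    -- where goodness applies.
    Good-long : ∀ {f W} → length W ≤ K → Good f W →
                ∀ g → length g ≤ K + K → (∀ v → boundary g v ≡ true → v ∈ W) → sumParity f g ≡ false
    Good-long {f} {W} W≤K good g len ∂⊆ with g′ , u , len′ , eq ← reduce g =
      trans (sym (eq f)) (good g′ (ℕ.≤-trans short W≤K) ∂⊆′)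
      where
      ∂⊆′ : ∀ v → boundary g′ v ≡ true → v ∈ W
      ∂⊆′ v ∂v = ∂⊆ v (trans (sym (eq (δ v))) ∂v)
      short : length g′ ≤ length W
      short = length≤boundary sparse _ g′ W refl u (ℕ.≤-trans len′ len) ∂⊆′

    -- A leaf of a nonempty reduced chain puts two distinct variables into the boundary, so a
    -- boundary inside a singleton forces the reduced chain to be empty.
    Good-point : ∀ z → Good (δ z) (z ∷ [])
    Good-point z g len ∂⊆ with reduce g
    ... | []    , _ , _    , eq = sym (eq (δ z))
    ... | g′@(x ∷ _) , u , len′ , eq
      with e , e∈ , j , j′ , j≢ , pj , pj′ ← leaf sparse g′ (here refl)
             (ℕ.≤-trans len′ (ℕ.≤-trans len (ℕ.m≤m+n K K))) =
      contradiction (trans (only pj′) (sym (only pj))) (private-alone u e∈ pj j′ (j≢ ∘ sym))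
      where
      only : ∀ {j} → ¬ Shared g′ e j → slot e j ≡ z
      only p with here eq′ ← ∂⊆ _ (trans (sym (eq _)) (private-∂ u e∈ p)) = eq′

    anyShort? : ∀ n {P : List Point → Set} → (∀ g → Dec (P g)) → Dec (∃ λ g → length g ≤ n × P g)
    anyShort? zero P? = map′ (λ p → [] , z≤n , p) (λ { ([] , _ , p) → p }) (P? [])
    anyShort? (suc n) {P} P? = map′
      (λ { (inj₁ p) → [] , z≤n , p ; (inj₂ (e , g , len , p)) → e ∷ g , s≤s len , p })
      (λ { ([] , _ , p) → inj₁ p ; (e ∷ g , s≤s len , p) → inj₂ (e , g , len , p) })
      (P? [] ⊎-dec anyPoint? λ e → anyShort? n (P? ∘ (e ∷_)))

    -- Such a chain dictates the new value at `v`. Ranging over the list of points keeps the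
    -- property decidable, so that the value can be found by search.
    Decisive : List Point → Point → List Point → Set
    Decisive W v g = boundary g v ≡ true × All (λ u → boundary g u ≡ true → u ∈ v ∷ W) (points S)

    decisive? : ∀ W v g → Dec (Decisive W v g)
    decisive? W v g = (boundary g v Bool.≟ true) ×-dec
      All.all? (λ u → (boundary g u Bool.≟ true) →-dec Any.any? (u ≟_) (v ∷ W)) (points S)

    sum-extend : ∀ {f v} d g →
                 sumParity (λ u → f u xor (d ∧ δ v u)) g ≡ sumParity f g xor (d ∧ boundary g v)
    sum-extend {f} {v} d g = trans (sumParity-xor f (λ u → d ∧ δ v u) g)
                                   (cong (sumParity f g xor_) (sumParity-∧ d (δ v) g))

    drop-head : ∀ {W v g} → boundary g v ≡ false → (∀ u → boundary g u ≡ true → u ∈ v ∷ W) →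
                ∀ u → boundary g u ≡ true → u ∈ W
    drop-head ∂v ∂⊆ u ∂u with ∂⊆ u ∂u
    ... | here refl = contradiction (trans (sym ∂u) ∂v) λ ()
    ... | there u∈  = u∈

    -- Two short chains through v whose other boundary points lie in W differ
    -- by a chain supported on W, so they impose the same value at v.
    extend-good : ∀ f W → length W ≤ K → Good f W → ∀ v →
                  ∃ λ d → Good (λ u → f u xor (d ∧ δ v u)) (v ∷ W) × (v ∈ W → d ≡ false)
    extend-good f W W≤K good v with Any.any? (v ≟_) W
    ... | yes v∈ = false , Good-⊇ merge (λ g len ∂⊆ → trans (sum-extend {f} {v} false g)
                             (trans (xor-identityʳ _) (good g len ∂⊆))) , λ _ → refl
      where
      merge : ∀ {u} → u ∈ v ∷ W → u ∈ W
      merge (here refl) = v∈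
      merge (there u∈)  = u∈
    ... | no v∉ = d , extended , λ v∈ → contradiction v∈ v∉
      where
      search : Dec (∃ λ g → length g ≤ K × Decisive W v g)
      search = anyShort? K (decisive? W v)

      value : Dec (∃ λ g → length g ≤ K × Decisive W v g) → Bool
      value (yes (g , _)) = sumParity f g
      -- No short chain constrains `v`, so the choice is free.
      value (no _)        = false

      d : Bool
      d = value search

      forced : ∀ s g → length g ≤ K → (∀ u → boundary g u ≡ true → u ∈ v ∷ W) →
               boundary g v ≡ true → sumParity f g ≡ value s
      forced (no none) g len ∂⊆ ∂v =
        contradiction (g , len , ∂v , All.tabulate λ {u} _ → ∂⊆ u) none
      forced (yes (g₁ , len₁ , ∂₁v , ∂₁⊆)) g len ∂⊆ ∂v = xor-cancelʳ (sumParity f g₁) (begin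
        sumParity f g xor sumParity f g₁  ≡⟨ sumParity-++ f g g₁ ⟨
        sumParity f (g ++ g₁)
          ≡⟨ Good-long W≤K good (g ++ g₁)
               (subst (_≤ K + K) (sym (length-++ g)) (ℕ.+-mono-≤ len len₁))
               (drop-head {g = g ++ g₁} (trans (sumParity-++ (δ v) g g₁) (cong₂ _xor_ ∂v ∂₁v)) both) ⟩
        false                             ≡⟨ xor-same (sumParity f g₁) ⟨
        sumParity f g₁ xor sumParity f g₁ ∎)
        where
        open ≡-Reasoning
        both : ∀ u → boundary (g ++ g₁) u ≡ true → u ∈ v ∷ W
        both u ∂u with boundary g u in eq
        ... | true  = ∂⊆ u eq
        ... | false = All.lookup ∂₁⊆ (∈-points S u)
          (trans (sym (trans (sumParity-++ (δ u) g g₁) (cong (_xor boundary g₁ u) eq))) ∂u)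

      extended : Good (λ u → f u xor (d ∧ δ v u)) (v ∷ W)
      extended g len ∂⊆ with boundary g v in ∂v
      ... | false = trans (sum-extend d g) (trans (cong (λ b → sumParity f g xor (d ∧ b)) ∂v)
                      (cong₂ _xor_ (good g len (drop-head {g = g} ∂v ∂⊆)) (∧-zeroʳ d)))
      ... | true  = trans (sum-extend d g) (trans (cong (λ b → sumParity f g xor (d ∧ b)) ∂v)
                      (trans (cong₂ _xor_ (forced search g len ∂⊆ ∂v) (∧-identityʳ d)) (xor-same d)))

    -- The flip at `z` alone is extended one point at a time; if `z` occurs again, the correction is
    -- `false`, which preserves `f z`. The strict bound leaves room for `z` itself.
    good-flip : ∀ z ws → length ws < K →
                ∃ λ f → f z ≡ true × Good f (ws ++ z ∷ [])
    good-flip z [] _ = δ z , δ-true refl , Good-point z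
    good-flip z (w ∷ ws) len
      with f , fz , good ← good-flip z ws (ℕ.<-trans (ℕ.n<1+n _) len)
      with d , good′ , fixed ← extend-good f (ws ++ z ∷ [])
             (ℕ.≤-trans (ℕ.≤-reflexive (trans (length-++ ws) (ℕ.+-comm (length ws) 1)))
                        (ℕ.<⇒≤ len)) good w =
      (λ u → f u xor (d ∧ δ w u)) , trans (cong₂ _xor_ fz keep) refl , good′
      where
      keep : d ∧ δ w z ≡ false
      keep with z ≟ w
      ... | yes refl = cong (_∧ δ w z) (fixed (∈-++⁺ʳ ws (here refl)))
      ... | no  z≢w  = trans (cong (d ∧_) (δ-false z≢w)) (∧-zeroʳ d)

-- A finitely axiomatized rigid class

-- F a: a is a foot; L: the strict weak order of the feet by segment;
-- E a X: the set X contains the segment of the foot a; R: the positive triples.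
multipede : Vocabulary
multipede = record { nsym = 4 ; arity = λ { 0F → 1 ; 1F → 2 ; 2F → 2 ; 3F → 3 } }

module _ {n : ℕ} where
  F′ : Fin n → FO multipede n
  F′ a = atom 0F (a ∷ [])

  L′ E′ sim′ : Fin n → Fin n → FO multipede n
  L′ a b = atom 1F (a ∷ b ∷ [])
  E′ a X = atom 2F (a ∷ X ∷ [])
  sim′ a b = and (neg (L′ a b)) (neg (L′ b a))

  R′ : Fin n → Fin n → Fin n → FO multipede n
  R′ a b c = atom 3F (a ∷ b ∷ c ∷ [])

  imp iff : FO multipede n → FO multipede n → FO multipede n
  imp φ ψ = or (neg φ) ψ
  iff φ ψ = and (imp φ ψ) (imp ψ φ)

  -- The graph of the map that swaps the feet over the segments in `X`.
  flip′ : Fin n → Fin n → Fin n → FO multipede n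
  flip′ X a b = and (F′ a) (or (and (E′ a X) (and (sim′ a b) (neg (equ a b))))
                               (and (neg (E′ a X)) (equ a b)))

-- `empty` and `insert` make every finite union of segments of feet an element, so that assignments
-- can be quantified over. In `odd` the set is `# 7` below the six quantifiers, and the triple
-- `# 5`, `# 4`, `# 3` is flipped to `# 2`, `# 1`, `# 0`.
irreflexive transitive pairs saturated empty insert extensional odd : Sentence multipede
irreflexive = all (neg (L′ (# 0) (# 0)))
transitive  = all (all (all (imp (and (L′ (# 2) (# 1)) (L′ (# 1) (# 0))) (L′ (# 2) (# 0)))))
pairs       = all (all (all (imp (and (F′ (# 2)) (and (sim′ (# 2) (# 1)) (sim′ (# 2) (# 0))))
                                 (or (equ (# 2) (# 1)) (or (equ (# 2) (# 0)) (equ (# 1) (# 0)))))))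
saturated   = all (all (all (imp (and (E′ (# 2) (# 0)) (sim′ (# 2) (# 1))) (E′ (# 1) (# 0)))))
empty       = ex (all (neg (E′ (# 0) (# 1))))
insert      = all (all (imp (F′ (# 0))
                (ex (all (iff (E′ (# 0) (# 1)) (or (E′ (# 0) (# 3)) (sim′ (# 2) (# 0))))))))
extensional = all (all (imp (and (neg (F′ (# 1))) (and (neg (F′ (# 0)))
                                 (all (iff (E′ (# 0) (# 2)) (E′ (# 0) (# 1))))))
                            (equ (# 1) (# 0))))
odd         = all (all (imp (E′ (# 0) (# 1)) (ex (ex (ex (ex (ex (ex
                (and (R′ (# 5) (# 4) (# 3)) (and (neg (R′ (# 2) (# 1) (# 0)))
                (and (flip′ (# 7) (# 5) (# 2)) (and (flip′ (# 7) (# 4) (# 1))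
                                                    (flip′ (# 7) (# 3) (# 0))))))))))))))

multipedes : Sentence multipede
multipedes = and irreflexive (and transitive (and pairs (and saturated
             (and empty (and insert (and extensional odd))))))

module _ (A : Structure multipede) where
  private U = Fin (size A)

  Foot : U → Set
  Foot a = T (rel A 0F (a ∷ []))

  Less Member Sim : U → U → Set
  Less a b   = T (rel A 1F (a ∷ b ∷ []))
  Member a X = T (rel A 2F (a ∷ X ∷ []))
  Sim a b    = ¬ Less a b × ¬ Less b a

modus-ponens : {P Q : Set} → ¬ P ⊎ Q → P → Q
modus-ponens (inj₁ ¬p) p = contradiction p ¬p
modus-ponens (inj₂ q)  _ = q

-- The iterates of `π` on `x` would form an infinite strictly ascending sequence in a finite set.
no-ascent : ∀ {n} (_≺_ : Fin n → Fin n → Set) → (∀ x → ¬ x ≺ x) →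
            (∀ x y z → x ≺ y → y ≺ z → x ≺ z) →
            (π : Fin n → Fin n) → (∀ {x y} → x ≺ y → π x ≺ π y) → ∀ x → ¬ x ≺ π x
no-ascent {n} _≺_ irr trn π mono x x≺ =
  let i , j , i<j , eq = Fin.pigeonhole (ℕ.n<1+n n) (iterate ∘ Fin.toℕ) in
  irr _ (subst (iterate (Fin.toℕ i) ≺_) (sym eq) (ascend i<j))
  where
  iterate : ℕ → Fin n
  iterate zero    = x
  iterate (suc i) = π (iterate i)
  step : ∀ i → iterate i ≺ iterate (suc i)
  step zero    = x≺
  step (suc i) = mono (step i)
  ascend : ∀ {i j} → i < j → iterate i ≺ iterate j
  ascend {i} {suc j} (s≤s i≤j) with ℕ.m≤n⇒m<n∨m≡n i≤j
  ... | inj₁ i<j  = trn _ _ _ (ascend i<j) (step j)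
  ... | inj₂ refl = step i

-- An automorphism stays within segments, by `no-ascent` for the order and its converse. On feet it
-- is therefore the flip over the set of moved feet; were that set inhabited, `odd` would give a
-- positive triple with a non-positive image. Extensionality then fixes the sets.
multipedes-rigid : (A : Structure multipede) → Models A multipedes → Rigid A
multipedes-rigid A (irr , trn , prs , sat , (∅ , ∅-empty) , ins , ext , odd) π aut = fixed
  where
  U = Fin (size A)
  p : U → U
  p = π ⟨$⟩ʳ_

  less-trans : ∀ x y z → Less A x y → Less A y z → Less A x z
  less-trans x y z xy yz = modus-ponens (trn x y z) (xy , yz)

  keep : ∀ r v → T (rel A r v) → T (rel A r (Vec.map p v))
  keep r v = subst T (sym (aut r v))

  back : ∀ r v → T (rel A r (Vec.map p v)) → T (rel A r v)
  back r v = subst T (aut r v)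

  p-sim : ∀ x → Sim A x (p x)
  p-sim x = no-ascent (Less A) irr less-trans p (keep 1F (_ ∷ _ ∷ [])) x
          , no-ascent (flip (Less A)) irr (λ x y z xy yz → less-trans z y x yz xy) p
                      (keep 1F (_ ∷ _ ∷ [])) x

  sim-sym : ∀ {x y} → Sim A x y → Sim A y x
  sim-sym (a , b) = b , a

  two-feet : ∀ {x y z} → Foot A x → Sim A x y → Sim A x z → x ≡ y ⊎ x ≡ z ⊎ y ≡ z
  two-feet fx xy xz = modus-ponens (prs _ _ _) (fx , xy , xz)

  MovedIn : List U → U → Set
  MovedIn xs b = ∃ λ x → x ∈ xs × Foot A x × p x ≢ x × Sim A x b

  -- Finite induction by `empty` and `insert`: the segments of the moved feet in `xs` are gathered
  -- into one element.
  collect : ∀ xs → ∃ λ Y → ∀ b → (Member A b Y → MovedIn xs b) × (MovedIn xs b → Member A b Y)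
  collect [] = ∅ , λ b → (λ m → contradiction m (∅-empty b)) , λ ()
  collect (x ∷ xs) with Y , spec ← collect xs
                   with T? (rel A 0F (x ∷ [])) | p x Fin.≟ x
  ... | no ¬fx | _ = Y , λ b →
        (λ m → let y , y∈ , q = proj₁ (spec b) m in y , there y∈ , q)
      , λ { (_ , here refl , fx , _) → contradiction fx ¬fx ; (y , there y∈ , q) → proj₂ (spec b) (y , y∈ , q) }
  ... | yes _ | yes px = Y , λ b →
        (λ m → let y , y∈ , q = proj₁ (spec b) m in y , there y∈ , q)
      , λ { (_ , here refl , _ , ne , _) → contradiction px ne ; (y , there y∈ , q) → proj₂ (spec b) (y , y∈ , q) }
  ... | yes fx | no px with Z , Z-spec ← modus-ponens (ins Y x) fx = Z , λ b → to b , from b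
    where
    to : ∀ b → Member A b Z → MovedIn (x ∷ xs) b
    to b m with modus-ponens (proj₁ (Z-spec b)) m
    ... | inj₁ m′ = let y , y∈ , q = proj₁ (spec b) m′ in y , there y∈ , q
    ... | inj₂ s  = x , here refl , fx , px , s
    from : ∀ b → MovedIn (x ∷ xs) b → Member A b Z
    from b (_ , here refl , _ , _ , s) = modus-ponens (proj₂ (Z-spec b)) (inj₂ s)
    from b (y , there y∈ , q) = modus-ponens (proj₂ (Z-spec b)) (inj₁ (proj₂ (spec b) (y , y∈ , q)))

  moved : U
  moved = proj₁ (collect (allFin _))

  moved⁺ : ∀ {b} → Foot A b → p b ≢ b → Member A b moved
  moved⁺ {b} fb pb = proj₂ (proj₂ (collect (allFin _)) b) (b , ∈-allFin b , fb , pb , irr b , irr b)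

  -- Membership only says that some foot `x` similar to `b` is moved. By `pairs`, `b` is `x` or
  -- `p x`, and injectivity moves `p x` too.
  moved⁻ : ∀ {b} → Foot A b → Member A b moved → p b ≢ b
  moved⁻ {b} fb m pb with x , _ , fx , px , s ← proj₁ (proj₂ (collect (allFin _)) b) m
                     with two-feet fx s (p-sim x)
  ... | inj₁ refl        = px pb
  ... | inj₂ (inj₁ x≡)   = px (sym x≡)
  ... | inj₂ (inj₂ refl) = px (p-injective pb)
    where
    p-injective : ∀ {x y} → p x ≡ p y → x ≡ y
    p-injective {x} {y} eq = trans (sym (Inverse.strictlyInverseʳ π x))
      (trans (cong (Inverse.from π) eq) (Inverse.strictlyInverseʳ π y))

  flip-p : ∀ {a b} → Foot A a × ((Member A a moved × Sim A a b × a ≢ b) ⊎ (¬ Member A a moved × a ≡ b)) →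
           b ≡ p a
  flip-p {a} (fa , inj₁ (m , s , a≢b)) with two-feet fa s (p-sim a)
  ... | inj₁ a≡b        = contradiction a≡b a≢b
  ... | inj₂ (inj₁ a≡)  = contradiction (sym a≡) (moved⁻ fa m)
  ... | inj₂ (inj₂ b≡)  = b≡
  flip-p {a} (fa , inj₂ (¬m , refl)) with p a Fin.≟ a
  ... | yes pa = sym pa
  ... | no pa  = contradiction (moved⁺ fa pa) ¬m

  foot-fixed : ∀ {a} → Foot A a → p a ≡ a
  foot-fixed {a} fa with p a Fin.≟ a
  ... | yes pa = pa
  ... | no pa with a₁ , a₂ , a₃ , b₁ , b₂ , b₃ , r , ¬r , f₁ , f₂ , f₃
                   ← modus-ponens (odd moved a) (moved⁺ fa pa)
              with refl ← flip-p f₁ | refl ← flip-p f₂ | refl ← flip-p f₃ =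
    contradiction (keep 3F (a₁ ∷ a₂ ∷ a₃ ∷ []) r) ¬r

  fixed : ∀ a → p a ≡ a
  fixed a with T? (rel A 0F (a ∷ []))
  ... | yes fa = foot-fixed fa
  -- `saturated` exchanges `b` for the similar `p b`, and the automorphism relates membership of
  -- `p b` in `p a` to that of `b` in `a`.
  ... | no ¬fa = modus-ponens (ext (p a) a) (¬fa ∘ back 0F (a ∷ []) , ¬fa , λ b →
      decide (λ m → back 2F (b ∷ a ∷ []) (modus-ponens (sat b (p b) (p a)) (m , p-sim b)))
    , decide (λ m → modus-ponens (sat (p b) b (p a)) (keep 2F (b ∷ a ∷ []) m , sim-sym (p-sim b))))
    where
    decide : ∀ {x} {Q : Set} → (T x → Q) → ¬ T x ⊎ Q
    decide {true}  f = inj₂ (f _)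
    decide {false} f = inj₁ λ ()

-- Back-and-forth systems for infinitary logic with counting

module _ {V : Vocabulary} (A : Structure V) where
  private U = Fin (size A)

  -- A winning strategy for the Duplicator in Hella's bijective game with `k` pebbles, played on `A`
  -- against itself. The bijection is named before the element, as counting requires.
  record BackAndForth (k : ℕ) (_∼_ : (Fin k → U) → (Fin k → U) → Set) : Set where
    field
      rel-≡  : ∀ {s t} → s ∼ t → ∀ r v → rel A r (Vec.map s v) ≡ rel A r (Vec.map t v)
      forth  : ∀ {s t} → s ∼ t → ∀ {i j} → s i ≡ s j → t i ≡ t j
      back   : ∀ {s t} → s ∼ t → ∀ {i j} → t i ≡ t j → s i ≡ s j
      move   : ∀ {s t} → s ∼ t → ∀ x → Σ (U ↔ U) λ h → ∀ a → update s x a ∼ update t x (Inverse.to h a)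

    -- Induction on the formula, in both directions at once because of negation. The bijection
    -- carries families of distinct witnesses to families of distinct witnesses.
    transfer : ∀ φ {s t} → s ∼ t → (SatLC A φ s → SatLC A φ t) × (SatLC A φ t → SatLC A φ s)
    transfer (atom r v) s∼t = subst T (rel-≡ s∼t r v) , subst T (sym (rel-≡ s∼t r v))
    transfer (equ i j)  s∼t = forth s∼t , back s∼t
    transfer (neg φ)    s∼t = let to , from = transfer φ s∼t in (_∘ from) , (_∘ to)
    transfer (bigAnd I φ) s∼t =
      (λ sat i → proj₁ (transfer (φ i) s∼t) (sat i)) , (λ sat i → proj₂ (transfer (φ i) s∼t) (sat i))
    transfer (bigOr I φ) s∼t =
      (λ (i , sat) → i , proj₁ (transfer (φ i) s∼t) sat) , (λ (i , sat) → i , proj₂ (transfer (φ i) s∼t) sat)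
    transfer (ex x φ) {s} {t} s∼t with h , step ← move s∼t x =
      (λ (a , sat) → to a , proj₁ (transfer φ (step a)) sat) ,
      (λ (b , sat) → from b , proj₂ (transfer φ (step (from b)))
                                (subst (SatLC A φ ∘ update t x) (sym (strictlyInverseˡ b)) sat))
      where open Inverse h
    transfer (all x φ) {s} {t} s∼t with h , step ← move s∼t x =
      (λ sat b → subst (SatLC A φ ∘ update t x) (strictlyInverseˡ b)
                   (proj₁ (transfer φ (step (from b))) (sat (from b)))) ,
      (λ sat a → proj₂ (transfer φ (step a)) (sat (to a)))
      where open Inverse h
    transfer (exAtLeast i x φ) {s} {t} s∼t with h , step ← move s∼t x =
      (λ (g , inj , sat) → to ∘ g , inj ∘ to-injective , λ j → proj₁ (transfer φ (step (g j))) (sat j)) ,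
      (λ (g , inj , sat) → from ∘ g , inj ∘ from-injective , λ j → proj₂ (transfer φ (step (from (g j))))
                (subst (SatLC A φ ∘ update t x) (sym (strictlyInverseˡ (g j))) (sat j)))
      where
      open Inverse h
      to-injective : Injective _≡_ _≡_ to
      to-injective {a} {b} eq = trans (sym (strictlyInverseʳ a)) (trans (cong from eq) (strictlyInverseʳ b))
      from-injective : Injective _≡_ _≡_ from
      from-injective {a} {b} eq = trans (sym (strictlyInverseˡ a)) (trans (cong to eq) (strictlyInverseˡ b))

bits↔ : ∀ n → Vec Bool n ↔ Fin (2 ^ n)
bits↔ zero    = mk↔ₛ′ (λ _ → zero) (λ _ → []) (λ { zero → refl }) (λ { [] → refl })
bits↔ (suc n) = ↔-sym Fin.*↔× ↔-∘ ((↔-sym Fin.2↔Bool ×-↔ bits↔ n) ↔-∘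
  mk↔ₛ′ (λ X → Vec.head X , Vec.tail X) (λ (b , X) → b ∷ X) (λ _ → refl) (λ { (_ ∷ _) → refl }))

-- Implication in the object language is a disjunction, so establishing it constructively means
-- deciding the premise.
implies : {P Q : Set} → Dec P → (P → Q) → ¬ P ⊎ Q
implies (yes p) f = inj₂ (f p)
implies (no ¬p) _ = inj₁ ¬p

-- The multipede of a system

module Multipede (S : System) where
  open System S
  open Inverse enum using () renaming (to to index; from to point)

  Universe : Set
  Universe = (Point × Bool) ⊎ Vec Bool order

  abstract
    universe↔ : Universe ↔ Fin (order * 2 + 2 ^ order)
    universe↔ = ↔-sym Fin.+↔⊎ ↔-∘
      ((↔-sym Fin.*↔× ↔-∘ (enum ×-↔ ↔-sym Fin.2↔Bool)) ⊎-↔ bits↔ order)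

  foot : Universe → Bool
  foot (inj₁ _) = true
  foot (inj₂ _) = false

  -- The two feet of a point have equal rank; all sets together form a single class above the feet.
  rank : Universe → ℕ
  rank (inj₁ (v , _)) = Fin.toℕ (index v)
  rank (inj₂ _)       = order

  less : Universe → Universe → Bool
  less x y = rank x <ᵇ rank y

  member : Universe → Universe → Bool
  member (inj₁ (v , _)) (inj₂ X) = lookup X (index v)
  member _              _        = false

  equation? : ∀ u v w → Dec (∃ λ e → slot e 0F ≡ u × slot e 1F ≡ v × slot e 2F ≡ w)
  equation? u v w = anyPoint? λ e → (slot e 0F ≟ u) ×-dec (slot e 1F ≟ v) ×-dec (slot e 2F ≟ w)

  positive : Universe → Universe → Universe → Bool
  positive (inj₁ (u , a)) (inj₁ (v , b)) (inj₁ (w , c)) = ⌊ equation? u v w ⌋ ∧ not (a xor (b xor c))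
  positive _ _ _ = false

  open Inverse universe↔ using (to; from; strictlyInverseˡ; strictlyInverseʳ)

  structure : Structure multipede
  structure = record
    { size = order * 2 + 2 ^ order
    ; rel  = λ { 0F (a ∷ [])         → foot (from a)
               ; 1F (a ∷ b ∷ [])     → less (from a) (from b)
               ; 2F (a ∷ b ∷ [])     → member (from a) (from b)
               ; 3F (a ∷ b ∷ c ∷ []) → positive (from a) (from b) (from c) }
    }

  Similar : Universe → Universe → Set
  Similar x y = ¬ T (less x y) × ¬ T (less y x)

  Similar⇒≡ : ∀ {x y} → Similar x y → rank x ≡ rank y
  Similar⇒≡ {x} {y} (x≮y , y≮x) =
    ℕ.≤-antisym (ℕ.≮⇒≥ (y≮x ∘ ℕ.<⇒<ᵇ)) (ℕ.≮⇒≥ (x≮y ∘ ℕ.<⇒<ᵇ))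

  ≡⇒Similar : ∀ {x y} → rank x ≡ rank y → Similar x y
  ≡⇒Similar {x} {y} eq = (λ lt → ℕ.<-irrefl eq (ℕ.<ᵇ⇒< (rank x) (rank y) lt))
                       , (λ lt → ℕ.<-irrefl (sym eq) (ℕ.<ᵇ⇒< (rank y) (rank x) lt))

  rank-foot : ∀ {v a y} → rank (inj₁ (v , a)) ≡ rank y → ∃ λ b → y ≡ inj₁ (v , b)
  rank-foot {v} {y = inj₁ (w , b)} eq = b , cong (λ u → inj₁ (u , b))
    (trans (sym (Inverse.strictlyInverseʳ enum w))
      (trans (cong point (sym (Fin.toℕ-injective eq))) (Inverse.strictlyInverseʳ enum v)))
  rank-foot {v} {y = inj₂ _} eq = contradiction eq (ℕ.<⇒≢ (Fin.toℕ<n (index v)))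

  pigeon : (a b c : Bool) → a ≡ b ⊎ a ≡ c ⊎ b ≡ c
  pigeon false false _     = inj₁ refl
  pigeon true  true  _     = inj₁ refl
  pigeon false true  false = inj₂ (inj₁ refl)
  pigeon false true  true  = inj₂ (inj₂ refl)
  pigeon true  false true  = inj₂ (inj₁ refl)
  pigeon true  false false = inj₂ (inj₂ refl)

  two-feet-U : ∀ x y z → T (foot x) → rank x ≡ rank y → rank x ≡ rank z → x ≡ y ⊎ x ≡ z ⊎ y ≡ z
  two-feet-U (inj₁ (v , a)) y z _ eq eq′
    with b , refl ← rank-foot {a = a} {y} eq | c , refl ← rank-foot {a = a} {z} eq′
    with pigeon a b c
  ... | inj₁ refl        = inj₁ refl
  ... | inj₂ (inj₁ refl) = inj₂ (inj₁ refl)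
  ... | inj₂ (inj₂ refl) = inj₂ (inj₂ refl)

  member-foot : ∀ x X → T (member x X) → ∃ λ v → ∃ λ b → x ≡ inj₁ (v , b)
  member-foot (inj₁ (v , b)) _ _ = v , b , refl

  member-rank : ∀ x y X → rank x ≡ rank y → T (member x X) → T (member y X)
  member-rank x y X eq m with v , a , refl ← member-foot x X m with b , refl ← rank-foot {a = a} {y} eq
    with inj₂ _ ← X = m

  -- A foot counts as the empty set, because `insert` allows any element as the set to be enlarged.
  content : Universe → Fin order → Bool
  content (inj₁ _) _ = false
  content (inj₂ X) i = lookup X i

  member-content : ∀ v b X → member (inj₁ (v , b)) X ≡ content X (index v)
  member-content v b (inj₁ _) = refl
  member-content v b (inj₂ _) = refl

  insertU : Universe → Point → Universe
  insertU X v = inj₂ (Vec.tabulate λ i → content X i ∨ ⌊ i Fin.≟ index v ⌋)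

  insertU⁻ : ∀ X v a y → T (member y (insertU X v)) → T (member y X) ⊎ Similar (inj₁ (v , a)) y
  insertU⁻ X v a y@(inj₁ (w , b)) m
    with Equivalence.to T-∨ (subst T (lookup∘tabulate (λ i → content X i ∨ ⌊ i Fin.≟ index v ⌋) (index w)) m)
  ... | inj₁ m′ = inj₁ (subst T (sym (member-content w b X)) m′)
  ... | inj₂ eq = inj₂ (≡⇒Similar {inj₁ (v , a)} {y} (cong Fin.toℕ (sym (toWitness eq))))

  insertU⁺ : ∀ X v a y → T (member y X) ⊎ Similar (inj₁ (v , a)) y → T (member y (insertU X v))
  insertU⁺ X v a y (inj₁ m) with w , b , refl ← member-foot y X m =
    subst T (sym (lookup∘tabulate (λ i → content X i ∨ ⌊ i Fin.≟ index v ⌋) (index w)))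
      (Equivalence.from T-∨ (inj₁ (subst T (member-content w b X) m)))
  insertU⁺ X v a y (inj₂ s) with b , refl ← rank-foot {a = a} {y} (Similar⇒≡ {inj₁ (v , a)} {y} s) =
    subst T (sym (lookup∘tabulate (λ i → content X i ∨ ⌊ i Fin.≟ index v ⌋) (index v)))
      (Equivalence.from (T-∨ {content X (index v)}) (inj₂ (fromWitness {a? = index v Fin.≟ index v} refl)))

  from-injective : ∀ {a b} → from a ≡ from b → a ≡ b
  from-injective {a} {b} eq = trans (sym (strictlyInverseˡ a)) (trans (cong to eq) (strictlyInverseˡ b))

  to-injective : ∀ {x y} → to x ≡ to y → x ≡ y
  to-injective {x} {y} eq = trans (sym (strictlyInverseʳ x)) (trans (cong from eq) (strictlyInverseʳ y))

  similar? : ∀ x y → Dec (Similar x y)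
  similar? x y = ¬? (T? _) ×-dec ¬? (T? _)

  Inserts : Universe → Universe → Universe → Set
  Inserts X x Y = ∀ y → (¬ T (member y Y) ⊎ (T (member y X) ⊎ Similar x y)) ×
                        (¬ (T (member y X) ⊎ Similar x y) ⊎ T (member y Y))

  insertion : ∀ X x → T (foot x) → ∃ (Inserts X x)
  insertion X x@(inj₁ (v , a)) _ = insertU X v , λ y →
    implies (T? _) (insertU⁻ X v a y) , implies (T? _ ⊎-dec similar? x y) (insertU⁺ X v a y)

  T-injective : ∀ {b c} → (T b → T c) → (T c → T b) → b ≡ c
  T-injective {false} {false} _ _ = refl
  T-injective {false} {true}  _ g = ⊥-elim (g _)
  T-injective {true}  {false} f _ = ⊥-elim (f _)
  T-injective {true}  {true}  _ _ = refl

  extensionality : ∀ X Y → ¬ T (foot X) → ¬ T (foot Y) →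
                   (∀ v → member (inj₁ (v , false)) X ≡ member (inj₁ (v , false)) Y) → X ≡ Y
  extensionality (inj₁ _) _        ¬f _  _  = ⊥-elim (¬f _)
  extensionality (inj₂ _) (inj₁ _) _  ¬f _  = ⊥-elim (¬f _)
  extensionality (inj₂ X) (inj₂ Y) _  _  eq = cong inj₂ (begin
    X                        ≡⟨ tabulate∘lookup X ⟨
    Vec.tabulate (lookup X)  ≡⟨ tabulate-cong (λ i → subst (λ i → lookup X i ≡ lookup Y i)
                                  (Inverse.strictlyInverseˡ enum i) (eq (point i))) ⟩
    Vec.tabulate (lookup Y)  ≡⟨ tabulate∘lookup Y ⟩
    Y                        ∎)
    where open ≡-Reasoning

  positive-to : ∀ x y z → positive (from (to x)) (from (to y)) (from (to z)) ≡ positive x y z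
  positive-to x y z rewrite strictlyInverseʳ x | strictlyInverseʳ y | strictlyInverseʳ z = refl

  private A = structure

  Flipped : Fin (size A) → Fin (size A) → Fin (size A) → Set
  Flipped X a b = Foot A a × ((Member A a X × Sim A a b × a ≢ b) ⊎ (¬ Member A a X × a ≡ b))

  flipped : ∀ X v → Flipped X (to (inj₁ (v , false))) (to (inj₁ (v , content (from X) (index v))))
  flipped X v with content (from X) (index v) in eq
  ... | false = subst (T ∘ foot) (sym (strictlyInverseʳ _)) tt
              , inj₂ ((λ m → subst T (trans (member-content v false (from X)) eq)
                         (subst (λ x → T (member x (from X))) (strictlyInverseʳ _) m)) , refl)
  ... | true  = subst (T ∘ foot) (sym (strictlyInverseʳ _)) tt
              , inj₁ ( subst (λ x → T (member x (from X))) (sym (strictlyInverseʳ _))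
                         (subst T (sym (trans (member-content v false (from X)) eq)) tt)
                     , ≡⇒Similar {from (to (inj₁ (v , false)))} {from (to (inj₁ (v , true)))}
                         (trans (cong rank (strictlyInverseʳ (inj₁ (v , false))))
                                (sym (cong rank (strictlyInverseʳ (inj₁ (v , true))))))
                     , λ eq′ → contradiction (to-injective eq′) λ () )

  models : Odd S → Models structure multipedes
  models odd-S = irreflexive′ , transitive′ , pairs′ , saturated′ , empty′ , insert′ , extensional′ , odd′
    where
    irreflexive′ : Models A irreflexive
    irreflexive′ a lt = ℕ.<-irrefl refl (ℕ.<ᵇ⇒< (rank (from a)) (rank (from a)) lt)

    transitive′ : Models A transitive
    transitive′ a b c = implies (T? _ ×-dec T? _) λ (ab , bc) →
      ℕ.<⇒<ᵇ (ℕ.<-trans (ℕ.<ᵇ⇒< (rank (from a)) (rank (from b)) ab)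
                       (ℕ.<ᵇ⇒< (rank (from b)) (rank (from c)) bc))

    pairs′ : Models A pairs
    pairs′ a b c = implies (T? _ ×-dec similar? (from a) (from b) ×-dec similar? (from a) (from c))
      λ (fa , ab , ac) → Sum.map from-injective (Sum.map from-injective from-injective)
        (two-feet-U (from a) (from b) (from c) fa
          (Similar⇒≡ {from a} {from b} ab) (Similar⇒≡ {from a} {from c} ac))

    saturated′ : Models A saturated
    saturated′ a b X = implies (T? _ ×-dec similar? (from a) (from b))
      λ (m , ab) → member-rank (from a) (from b) (from X) (Similar⇒≡ {from a} {from b} ab) m

    empty′ : Models A empty
    empty′ = to ∅ , λ b → subst (λ X → ¬ T (member (from b) X)) (sym (strictlyInverseʳ ∅)) (∅-empty (from b))
      where
      ∅ : Universe
      ∅ = inj₂ (Vec.replicate order false)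
      ∅-empty : ∀ y → ¬ T (member y ∅)
      ∅-empty (inj₁ (v , _)) = subst T (lookup-replicate (index v) false)

    insert′ : Models A insert
    insert′ X a = implies (T? _) λ fa → let Y , spec = insertion (from X) (from a) fa in
      to Y , λ b → subst (Inserts (from X) (from a)) (sym (strictlyInverseʳ Y)) spec (from b)

    extensional′ : Models A extensional
    extensional′ X Y = implies
      (¬? (T? _) ×-dec ¬? (T? _) ×-dec Fin.all? λ _ → (¬? (T? _) ⊎-dec T? _) ×-dec (¬? (T? _) ⊎-dec T? _))
      λ (¬fX , ¬fY , same) → from-injective (extensionality (from X) (from Y) ¬fX ¬fY λ v →
        subst (λ x → member x (from X) ≡ member x (from Y)) (strictlyInverseʳ (inj₁ (v , false)))
          (let X⇒Y , Y⇒X = same (to (inj₁ (v , false))) in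
           T-injective (modus-ponens X⇒Y) (modus-ponens Y⇒X)))

    -- At an equation violated by the characteristic function of `X`, the triple of `false` feet is
    -- positive, and its flip has odd parity.
    odd′ : Models A odd
    odd′ X b = implies (T? _) λ m →
      let v , a , eq = member-foot (from b) (from X) m
          e , pe = odd-S f v (Equivalence.to T-≡ (subst T (member-content v a (from X))
                     (subst (λ x → T (member x (from X))) eq m)))
      in to (feet₀ e 0F) , to (feet₀ e 1F) , to (feet₀ e 2F)
       , to (feet₁ e 0F) , to (feet₁ e 1F) , to (feet₁ e 2F)
       , subst T (sym (positive-to (feet₀ e 0F) (feet₀ e 1F) (feet₀ e 2F)))
           (Equivalence.from T-∧ (fromWitness (e , refl , refl , refl) , tt))
       , (λ r → subst (T ∘ not) pe (proj₂ (Equivalence.to T-∧ (subst T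
           (positive-to (feet₁ e 0F) (feet₁ e 1F) (feet₁ e 2F)) r))))
       , flipped X (slot e 0F) , flipped X (slot e 1F) , flipped X (slot e 2F)
      where
      f : Point → Bool
      f v = content (from X) (index v)
      feet₀ feet₁ : Point → Fin 3 → Universe
      feet₀ e j = inj₁ (slot e j , false)
      feet₁ e j = inj₁ (slot e j , f (slot e j))

-- The bijective pebble game

-- The bound is `suc k` rather than `k` because `z` is kept next to the `k` pebbles.
module Game (S : System) (k : ℕ) (sparse : Sparse S (suc k + suc k)) (z : System.Point S) where
  open System S
  open Chains S
  open Flips (suc k) sparse
  open Multipede S
  open Inverse universe↔ using (to; from; strictlyInverseʳ)

  flipFeet : (Point → Bool) → Universe → Universe
  flipFeet f (inj₁ (v , b)) = inj₁ (v , b xor f v)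
  flipFeet f (inj₂ X)       = inj₂ X

  -- Sets are sent to z, which counts as pebbled throughout.
  pointOf : Universe → Point
  pointOf (inj₁ (v , _)) = v
  pointOf (inj₂ _)       = z

  flipFeet-involutive : ∀ f x → flipFeet f (flipFeet f x) ≡ x
  flipFeet-involutive f (inj₁ (v , b)) = cong (λ c → inj₁ (v , c))
    (trans (xor-assoc b (f v) (f v)) (trans (cong (b xor_) (xor-same (f v))) (xor-identityʳ b)))
  flipFeet-involutive f (inj₂ X) = refl

  flipFeet-cong : ∀ {f h} x → f (pointOf x) ≡ h (pointOf x) → flipFeet f x ≡ flipFeet h x
  flipFeet-cong (inj₁ (v , b)) eq = cong (λ c → inj₁ (v , b xor c)) eq
  flipFeet-cong (inj₂ X)       _  = refl

  flip↔ : (Point → Bool) → Fin (size structure) ↔ Fin (size structure)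
  flip↔ f = universe↔ ↔-∘ (mk↔ₛ′ (flipFeet f) (flipFeet f) (flipFeet-involutive f) (flipFeet-involutive f)
                            ↔-∘ ↔-sym universe↔)

  foot-flip : ∀ f x → foot (flipFeet f x) ≡ foot x
  foot-flip f (inj₁ _) = refl
  foot-flip f (inj₂ _) = refl

  rank-flip : ∀ f x → rank (flipFeet f x) ≡ rank x
  rank-flip f (inj₁ _) = refl
  rank-flip f (inj₂ _) = refl

  member-flip : ∀ f x X → member (flipFeet f x) (flipFeet f X) ≡ member x X
  member-flip f (inj₁ _) (inj₁ _) = refl
  member-flip f (inj₁ _) (inj₂ _) = refl
  member-flip f (inj₂ _) (inj₁ _) = refl
  member-flip f (inj₂ _) (inj₂ _) = refl

  -- Goodness is applied to the chain consisting of `e` alone, whose boundary lies among its own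
  -- variables.
  parity-good : ∀ {f W} → Good f W → ∀ e → (∀ j → slot e j ∈ W) → parity f e ≡ false
  parity-good {f} {W} good e ∈W = trans (sym (xor-identityʳ _)) (good (e ∷ []) (s≤s z≤n) ∂⊆)
    where
    ∂⊆ : ∀ v → boundary (e ∷ []) v ≡ true → v ∈ W
    ∂⊆ v ∂v with Fin.any? (λ j → slot e j ≟ v)
    ... | yes (j , refl) = ∈W j
    ... | no  away       = contradiction (trans (sym ∂v)
                             (boundary-∉ (e ∷ []) λ { _ j (here refl) eq → away (j , eq) })) λ ()

  positive-flip : ∀ {f W} → Good f W → ∀ x y w → pointOf x ∈ W → pointOf y ∈ W → pointOf w ∈ W →
                  positive (flipFeet f x) (flipFeet f y) (flipFeet f w) ≡ positive x y w
  positive-flip {f} good (inj₁ (u , a)) (inj₁ (v , b)) (inj₁ (w , c)) u∈ v∈ w∈ with equation? u v w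
  ... | no _ = refl
  ... | yes (e , refl , refl , refl) = cong not (begin
    (a xor f u) xor ((b xor f v) xor (c xor f w))
      ≡⟨ cong ((a xor f u) xor_) (xor-interchange b (f v) c (f w)) ⟩
    (a xor f u) xor ((b xor c) xor (f v xor f w))
      ≡⟨ xor-interchange a (f u) (b xor c) (f v xor f w) ⟩
    (a xor (b xor c)) xor parity f e
      ≡⟨ cong ((a xor (b xor c)) xor_) (parity-good good e λ { 0F → u∈ ; 1F → v∈ ; 2F → w∈ }) ⟩
    (a xor (b xor c)) xor false
      ≡⟨ xor-identityʳ _ ⟩
    a xor (b xor c) ∎)
    where open ≡-Reasoning
  positive-flip good (inj₁ _) (inj₁ _) (inj₂ _) _ _ _ = refl
  positive-flip good (inj₁ _) (inj₂ _) _        _ _ _ = refl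
  positive-flip good (inj₂ _) _        _        _ _ _ = refl

  Assignment : Set
  Assignment = Fin k → Fin (size structure)

  pebbled : Assignment → List Point
  pebbled s = tabulate (pointOf ∘ from ∘ s) ++ z ∷ []

  length-pebbled : ∀ s → length (pebbled s) ≤ suc k
  length-pebbled s = ℕ.≤-reflexive (trans (length-++ (tabulate (pointOf ∘ from ∘ s)))
    (trans (ℕ.+-comm _ 1) (cong suc (length-tabulate (pointOf ∘ from ∘ s)))))

  ∈-pebbled : ∀ s i → pointOf (from (s i)) ∈ pebbled s
  ∈-pebbled s i = ∈-++⁺ˡ (∈-tabulate⁺ i)

  _∼_ : Assignment → Assignment → Set
  s ∼ t = ∃ λ f → Good f (pebbled s) × ∀ i → from (t i) ≡ flipFeet f (from (s i))

  pebbled-update : ∀ s x a {v} → v ∈ pebbled (update s x a) → v ∈ pointOf (from a) ∷ pebbled s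
  pebbled-update s x a v∈ with ∈-++⁻ (tabulate (pointOf ∘ from ∘ update s x a)) v∈
  ... | inj₂ (here refl) = there (∈-++⁺ʳ (tabulate (pointOf ∘ from ∘ s)) (here refl))
  ... | inj₁ v∈s with i , refl ← ∈-tabulate⁻ v∈s with i Fin.≟ x
  ...   | yes _ = here refl
  ...   | no  _ = there (∈-pebbled s i)

  back-and-forth : BackAndForth structure k _∼_
  back-and-forth = record { rel-≡ = rel-≡ ; forth = forth ; back = back ; move = move }
    where
    forth : ∀ {s t} → s ∼ t → ∀ {i j} → s i ≡ s j → t i ≡ t j
    forth (f , _ , t≡) {i} {j} eq = from-injective
      (trans (t≡ i) (trans (cong (flipFeet f ∘ from) eq) (sym (t≡ j))))

    back : ∀ {s t} → s ∼ t → ∀ {i j} → t i ≡ t j → s i ≡ s j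
    back (f , _ , t≡) {i} {j} eq = from-injective
      (trans (sym (flipFeet-involutive f _))
        (trans (cong (flipFeet f) (trans (sym (t≡ i)) (trans (cong from eq) (t≡ j))))
          (flipFeet-involutive f _)))

    rel-≡ : ∀ {s t} → s ∼ t → ∀ r v → rel structure r (Vec.map s v) ≡ rel structure r (Vec.map t v)
    rel-≡ (f , _ , t≡) 0F (a ∷ []) rewrite t≡ a = sym (foot-flip f _)
    rel-≡ {s} (f , _ , t≡) 1F (a ∷ b ∷ []) rewrite t≡ a | t≡ b =
      sym (cong₂ _<ᵇ_ (rank-flip f (from (s a))) (rank-flip f (from (s b))))
    rel-≡ {s} (f , _ , t≡) 2F (a ∷ b ∷ []) rewrite t≡ a | t≡ b = sym (member-flip f (from (s a)) (from (s b)))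
    rel-≡ {s} (f , good , t≡) 3F (a ∷ b ∷ c ∷ []) rewrite t≡ a | t≡ b | t≡ c =
      sym (positive-flip good (from (s a)) (from (s b)) (from (s c)) (∈-pebbled s a) (∈-pebbled s b) (∈-pebbled s c))

    -- Every point `v` has its own extension of `f`, and `f⁺` takes from it the value at `v`. This
    -- diagonal flip is a bijection, as it acts over each point separately; goodness is needed only
    -- for the extension at the point actually chosen.
    move : ∀ {s t} → s ∼ t → ∀ x → Σ (Fin (size structure) ↔ Fin (size structure)) λ h →
           ∀ a → update s x a ∼ update t x (Inverse.to h a)
    move {s} {t} (f , good , t≡) x = flip↔ f⁺ , λ a → extended (pointOf (from a))
      , Good-⊇ (pebbled-update s x a) (proj₁ (proj₂ (step (pointOf (from a))))) , agree a
      where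
      step : ∀ v → ∃ λ d → Good (λ u → f u xor (d ∧ δ v u)) (v ∷ pebbled s) × (v ∈ pebbled s → d ≡ false)
      step = extend-good f (pebbled s) (length-pebbled s) good

      extended : Point → Point → Bool
      extended v u = f u xor (proj₁ (step v) ∧ δ v u)

      f⁺ : Point → Bool
      f⁺ v = extended v v

      -- The correction lives at `v` alone and vanishes if `v` was pebbled before, so the old
      -- pebbles keep their images.
      extended-old : ∀ v {u} → u ∈ pebbled s → f u ≡ extended v u
      extended-old v {u} u∈ = sym (trans (cong (f u xor_) unchanged) (xor-identityʳ (f u)))
        where
        unchanged : proj₁ (step v) ∧ δ v u ≡ false
        unchanged with u ≟ v
        ... | yes refl = cong (_∧ δ v v) (proj₂ (proj₂ (step v)) u∈)
        ... | no  u≢v  = trans (cong (proj₁ (step v) ∧_) (δ-false u≢v)) (∧-zeroʳ _)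

      agree : ∀ a i → from (update t x (Inverse.to (flip↔ f⁺) a) i) ≡
                      flipFeet (extended (pointOf (from a))) (from (update s x a i))
      agree a i with i Fin.≟ x
      ... | yes _ = trans (strictlyInverseʳ _) (flipFeet-cong (from a) refl)
      ... | no  _ = trans (t≡ i) (flipFeet-cong (from (s i)) (extended-old (pointOf (from a)) (∈-pebbled s i)))

-- Indistinguishable feet and the failure of definable orders

module _ {S : System} {m : ℕ} (z : System.Point S)
         (sparse : Sparse S (suc (suc (suc m)) + suc (suc (suc m)))) (φ : LC multipede (suc (suc m))) where
  open Chains.Flips S (suc (suc (suc m))) sparse
  open Multipede S
  open Game S (suc (suc m)) sparse z
  open Inverse universe↔ using (to; from; strictlyInverseʳ)
  open BackAndForth back-and-forth using (transfer)

  end : Bool → Fin (size structure)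
  end b = to (inj₁ (z , b))

  -- The remaining variables are read universally, so an arbitrary assignment `s` is given first; a
  -- flip that is good on all its values and swaps the feet of `z` links it to one covered by the
  -- hypothesis.
  swap-ends : ∀ b c → Defined structure φ (end b) (end c) →
              Defined structure φ (end (not b)) (end (not c))
  swap-ends b c defined s s₀ s₁
    with f , fz , good ← good-flip z (tabulate (pointOf ∘ from ∘ s))
                           (s≤s (ℕ.≤-reflexive (length-tabulate (pointOf ∘ from ∘ s)))) =
    proj₂ (transfer φ (f , good , λ i → strictlyInverseʳ (flipFeet f (from (s i)))))
          (defined (λ i → to (flipFeet f (from (s i)))) (flip-end b s₀) (flip-end c s₁))
    where
    flip-end : ∀ b {a} → a ≡ end (not b) → to (flipFeet f (from a)) ≡ end b
    flip-end b refl = cong to (trans (cong (flipFeet f) (strictlyInverseʳ _))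
      (cong (λ c → inj₁ (z , c)) (trans (cong (not b xor_) fz)
        (trans (xor-comm (not b) true) (not-involutive b)))))

  not-order : ¬ IsLinearOrder (Defined structure φ)
  not-order order with IsStrictTotalOrder.compare order (end false) (end true)
  ... | tri< lt _ _ = IsStrictTotalOrder.asym order lt (swap-ends false true lt)
  ... | tri≈ _ eq _ = contradiction (to-injective eq) λ ()
  ... | tri> _ _ gt = IsStrictTotalOrder.asym order gt (swap-ends true false gt)

theorem4p1 : Σ Vocabulary λ V → Σ (Sentence V) λ ψ →
    ((A : Structure V) → Models A ψ → Rigid A) ×
    ((m : ℕ) (φ : LC V (suc (suc m))) →
    ¬ ((A : Structure V) → Models A ψ → IsLinearOrder (Defined A φ)))
theorem4p1 = multipede , multipedes , multipedes-rigid , λ m φ linear →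
  -- The `m + 2` variables and the point `z`; the structure is chosen after the formula.
  let K = suc (suc (suc m))
      S , z , sparse , odd-S = sparse-odd-system (K + K)
  in not-order z sparse φ (linear (Multipede.structure S) (Multipede.models S odd-S))
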